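{- For every integer $k\ge 1$ and every integer $c\ge 0$, there are only finitely many (up to isomorphism) $k$-vertex-critical $(\text{co-gem}, P_5, P_3+cP_2)$-free graphs.
   Context: All graphs are finite and simple. $\chi(G)$ denotes the chromatic number of $G$. A graph $G$ is $k$-vertex-critical if $\chi(G)=k$ and $\chi(G-v)<k$ for every $v\in V(G)$. $P_n$ denotes the path on $n$ vertices, $G+H$ denotes the disjoint union of graphs $G$ and $H$, and $cG$ denotes the disjoint union of $c$ copies of $G$ (so $P_3+0P_2=P_3$). The co-gem is the graph $P_4+P_1$. A graph is $(H_1,\dots,H_m)$-free if none of $H_1,\dots,H_m$ is isomorphic to an induced subgraph of it. -}

module Defs where

open import Data.Bool using (Bool; true; false)
open import Data.Fin using (Fin; toℕ; splitAt; punchIn)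
open import Data.Fin.Properties using (punchIn-injective)
open import Data.List using (List)
open import Data.List.Relation.Unary.All using (All)
open import Data.List.Relation.Unary.Any using (Any)
open import Data.Nat using (ℕ; zero; suc; pred; _+_; _*_; _≤_; _<_; _≡ᵇ_; ∣_-_∣)
open import Data.Nat.Properties using (∣-∣-comm; ∣n-n∣≡0)
open import Data.Product using (Σ; ∃; _×_; _,_; proj₂)
open import Data.Sum using (_⊎_; inj₁; inj₂)
open import Function.Bundles using (_↔_; _↣_; mk↣; module Inverse; module Injection)
open import Relation.Binary.PropositionalEquality using (_≡_; _≢_; refl; cong)
open import Relation.Nullary using (¬_)

private
  variable
    m n : ℕ

-- Finite simple graphs with vertex set Fin n.
record Graph (n : ℕ) : Set where
  field
    adj    : Fin n → Fin n → Bool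
    sym    : ∀ u v → adj u v ≡ adj v u
    irrefl : ∀ v → adj v v ≡ false

open Graph public

infix 4 _≅_ _⊑_

_≅_ : Graph m → Graph n → Set
_≅_ {m} {n} G H =
  Σ (Fin m ↔ Fin n) λ φ → ∀ u v → adj G u v ≡ adj H (Inverse.to φ u) (Inverse.to φ v)

-- The subgraph of G induced by the image of f, with its vertices relabelled
-- by Fin m along f.
infix 8 _[_]

_[_] : Graph n → (Fin m ↣ Fin n) → Graph m
G [ f ] = record
  { adj    = λ u v → adj G (to u) (to v)
  ; sym    = λ u v → sym G (to u) (to v)
  ; irrefl = λ v → irrefl G (to v)
  }
  where open Injection f using (to)

_⊑_ : Graph m → Graph n → Set
_⊑_ {m} {n} H G = Σ (Fin m ↣ Fin n) λ f → H ≅ G [ f ]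

Free : List (∃ Graph) → Graph n → Set
Free Hs G = All (λ H → ¬ (proj₂ H ⊑ G)) Hs

infixl 7 _-ᵥ_

_-ᵥ_ : Graph n → Fin n → Graph (pred n)
_-ᵥ_ {suc n} G v = G [ mk↣ (λ {x} {y} → punchIn-injective v x y) ]

path : ∀ n → Graph n
path n = record
  { adj    = λ u v → ∣ toℕ u - toℕ v ∣ ≡ᵇ 1
  ; sym    = λ u v → cong (_≡ᵇ 1) (∣-∣-comm (toℕ u) (toℕ v))
  ; irrefl = λ v → cong (_≡ᵇ 1) (∣n-n∣≡0 (toℕ v))
  }

infixl 6 _⊕_
infixr 7 _·_

-- Disjoint union; the first m vertices form G, the remaining n form H.
_⊕_ : Graph m → Graph n → Graph (m + n)
_⊕_ {m} {n} G H = record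
  { adj    = λ u v → adj⊎ (splitAt m u) (splitAt m v)
  ; sym    = λ u v → sym⊎ (splitAt m u) (splitAt m v)
  ; irrefl = λ v → irrefl⊎ (splitAt m v)
  }
  where
  adj⊎ : Fin m ⊎ Fin n → Fin m ⊎ Fin n → Bool
  adj⊎ (inj₁ u) (inj₁ v) = adj G u v
  adj⊎ (inj₂ u) (inj₂ v) = adj H u v
  adj⊎ (inj₁ _) (inj₂ _) = false
  adj⊎ (inj₂ _) (inj₁ _) = false

  sym⊎ : ∀ u v → adj⊎ u v ≡ adj⊎ v u
  sym⊎ (inj₁ u) (inj₁ v) = sym G u v
  sym⊎ (inj₂ u) (inj₂ v) = sym H u v
  sym⊎ (inj₁ _) (inj₂ _) = refl
  sym⊎ (inj₂ _) (inj₁ _) = refl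

  irrefl⊎ : ∀ v → adj⊎ v v ≡ false
  irrefl⊎ (inj₁ v) = irrefl G v
  irrefl⊎ (inj₂ v) = irrefl H v

_·_ : (c : ℕ) → Graph n → Graph (c * n)
zero  · G = record { adj = λ () ; sym = λ () ; irrefl = λ () }
suc c · G = G ⊕ c · G

coGem : Graph 5
coGem = path 4 ⊕ path 1

Colourable : Graph n → ℕ → Set
Colourable {n} G k =
  Σ (Fin n → Fin k) λ f → ∀ u v → adj G u v ≡ true → f u ≢ f v

-- χ(G) = k, as a relation: there is exactly one such k for each G.
HasChromaticNumber : Graph n → ℕ → Set
HasChromaticNumber G k = Colourable G k × (∀ j → Colourable G j → k ≤ j)

VertexCritical : ℕ → Graph n → Set
VertexCritical k G =
  HasChromaticNumber G k ×
  (∀ v → ∃ λ j → HasChromaticNumber (G -ᵥ v) j × j < k)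

-- Some finite list contains an isomorphic copy of every graph satisfying P
-- (the list may also contain graphs not satisfying P).
FinitelyManyUpToIso : (∀ {n} → Graph n → Set) → Set
FinitelyManyUpToIso P =
  Σ (List (∃ Graph)) λ Gs → ∀ {n} (G : Graph n) → P G → Any (λ H → G ≅ proj₂ H) Gs

{-# OPTIONS --safe #-}
-- A k-vertex-critical graph G has no endomorphism that misses a vertex, as one could
-- colour G through it.  In particular two non-adjacent vertices have incomparable
-- neighbourhoods.  A large G contains a large independent set I (a colour class).  Fix
-- r ∈ I and give every other b ∈ I a neighbour u_b not adjacent to r, all u_b of one
-- colour.  Either some u_b sees many vertices of I, and we continue in its neighbourhood,
-- the chosen u_b forming a clique (hence at most k rounds), or I contains many b whose
-- edges b u_b form an induced matching.
-- In a large induced matching, enlarge every edge to the clique C_i of vertices seeing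
-- exactly that edge.  A vertex outside these cliques with a neighbour in one of them is
-- complete to all but a bounded number of them, and for non-adjacent such vertices the
-- cliques missed agree; so all but boundedly many C_j are complete to all these vertices.
-- Given two such cliques, the smaller one can be mapped into the larger one by an
-- endomorphism fixing everything else.
module Submission where

open import Data.Bool using (Bool; true; false; _∧_; not)
import Data.Bool.Properties as Bool
open import Data.Empty using (⊥; ⊥-elim)
open import Data.Fin as Fin using (Fin; remQuot; zero; suc; splitAt; join; punchOut; combine; finToFun; funToFin; inject≤; _≟_)
open import Data.Fin.Patterns using (0F; 1F; 2F; 3F; 4F)
open import Data.Fin.Properties using (any?; <-cmp; remQuot-combine; all?; join-splitAt; punchIn-punchOut; finToFun-funToFin; inject≤-injective; 2↔Bool)
open import Data.List using (List; []; _∷_; length; filter; map; concatMap; lookup; allFin; upTo)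
open import Data.List.Properties using (filter-all; length-tabulate)
open import Data.List.Membership.Propositional using (_∈_; lose; find)
open import Data.List.Membership.Propositional.Properties using (∈-filter⁺; ∈-filter⁻; ∈-lookup; ∈-allFin; ∈-map⁺; ∈-concatMap⁺; ∈-upTo⁺)
open import Data.List.Relation.Binary.Sublist.Propositional using (_⊆_; _∷ʳ_; ⊆-refl)
open import Data.List.Relation.Binary.Sublist.Propositional.Properties using (filter-⊆; length-mono-≤; filter⁺)
open import Data.List.Relation.Unary.All as All using (All; []; _∷_)
import Data.List.Relation.Unary.All.Properties as All
open import Data.List.Relation.Unary.AllPairs as AllPairs using (AllPairs; []; _∷_)
import Data.List.Relation.Unary.AllPairs.Properties as AllPairs
open import Data.List.Relation.Unary.Any as Any using (Any; here; there)
import Data.List.Relation.Unary.Any.Properties as Any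
open import Data.List.Relation.Unary.Unique.Propositional using (Unique)
open import Data.List.Relation.Unary.Unique.Propositional.Properties using (allFin⁺)
open import Data.Nat using (ℕ; zero; suc; _+_; _*_; _^_; _≤_; _<_; _≥_; z≤n; s≤s; s≤s⁻¹; _<?_)
import Data.Nat.Properties as ℕ
open import Data.Product using (∃; ∃₂; _×_; _,_; proj₁; proj₂)
open import Data.Sum using (_⊎_; inj₁; inj₂; [_,_]′)
open import Function using (_∘_; id; case_of_)
open import Function.Bundles using (Inverse; mk↣)
open import Function.Construct.Identity using (↔-id)
open import Function.Definitions using (Injective)
open import Relation.Binary.Definitions using (Symmetric; tri<; tri≈; tri>) renaming (Decidable to Decidable₂)
open import Relation.Binary.PropositionalEquality using (_≡_; _≢_; refl; cong; cong₂; trans; subst; module ≡-Reasoning) renaming (sym to ≡-sym)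
open import Relation.Nullary using (¬_; Dec; yes; no; does; contradiction)
open import Relation.Nullary.Decidable using (¬?; _×-dec_; _⊎-dec_; _→-dec_; from-yes; decidable-stable)
open import Relation.Unary using (Decidable)
open import Defs

private
  variable
    A : Set
    m n : ℕ

-- Counting in lists: pigeonhole, greedy selection and total choice.

length-filter-∁ : ∀ {P : A → Set} (P? : Decidable P) xs →
  length xs ≡ length (filter P? xs) + length (filter (¬? ∘ P?) xs)
length-filter-∁ P? [] = refl
length-filter-∁ P? (x ∷ xs) with does (P? x)
... | true  = cong suc (length-filter-∁ P? xs)
... | false = trans (cong suc (length-filter-∁ P? xs)) (≡-sym (ℕ.+-suc _ _))

length-filter-mono : ∀ {P : A → Set} (P? : Decidable P) {xs ys} → xs ⊆ ys →
  length (filter P? xs) ≤ length (filter P? ys)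
length-filter-mono P? xs⊆ys = length-mono-≤ (filter⁺ P? P? (λ { refl Px → Px }) xs⊆ys)

pigeonhole : ∀ k {P : Fin k → A → Set} (P? : ∀ p → Decidable (P p)) M xs →
  All (λ x → ∃ λ p → P p x) xs → k * M < length xs →
  ∃ λ p → M < length (filter (P? p) xs)
pigeonhole zero    P? M (x ∷ xs) ((() , _) ∷ _) _
pigeonhole (suc k) {P} P? M xs all-P h with M <? length (filter (P? zero) xs)
... | yes M< = zero , M<
... | no  M≮ =
  let p , M< = pigeonhole k (P? ∘ suc) M rest (All.tabulate later) kM<rest
  in suc p , ℕ.<-≤-trans M< (length-filter-mono (P? (suc p)) (filter-⊆ _ xs))
  where
  rest = filter (¬? ∘ P? zero) xs
  later : ∀ {x} → x ∈ rest → ∃ λ p → P (suc p) x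
  later x∈ with ∈-filter⁻ (¬? ∘ P? zero) {xs = xs} x∈
  ... | x∈xs , ¬P₀ with All.lookup all-P x∈xs
  ...   | zero  , P₀ = contradiction P₀ ¬P₀
  ...   | suc p , Pₚ = p , Pₚ
  kM<rest : k * M < length rest
  kM<rest = ℕ.+-cancelˡ-< M _ _ (ℕ.<-≤-trans h (ℕ.≤-trans (ℕ.≤-reflexive (length-filter-∁ (P? zero) xs))
    (ℕ.+-monoˡ-≤ _ (ℕ.≮⇒≥ M≮))))

popular-value : ∀ {k} (f : A → Fin k) M xs → k * M < length xs →
  ∃ λ p → M < length (filter (λ x → f x ≟ p) xs)
popular-value f M xs = pigeonhole _ (λ p x → f x ≟ p) M xs (All.universal (λ x → f x , refl) xs)

-- If `x` has at most `M` successors under `R`, keeping `x` and discarding them costs at most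
-- `suc M` elements per round. As `R` is not symmetric, the selection only excludes `R` from earlier
-- to later elements.
greedy : ∀ {R S : A → A → Set} (R? : Decidable₂ R) M t xs →
  AllPairs S xs → t * suc M ≤ length xs →
  (∃ λ x → x ∈ xs × M < length (filter (R? x) xs)) ⊎
  (∃ λ ys → t ≤ length ys × All (_∈ xs) ys × AllPairs (λ x y → S x y × ¬ R x y) ys)
greedy R? M zero    xs _ _ = inj₂ ([] , z≤n , [] , [])
greedy R? M (suc t) (x ∷ xs) (Sx ∷ Sxs) (s≤s h) with M <? length (filter (R? x) xs)
... | yes M< = inj₁ (x , here refl , ℕ.<-≤-trans M< (length-filter-mono (R? x) (x ∷ʳ ⊆-refl)))
... | no  M≮ with greedy R? M t rest (AllPairs.filter⁺ (¬? ∘ R? x) Sxs) len-rest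
  where
  rest = filter (¬? ∘ R? x) xs
  len-rest : t * suc M ≤ length rest
  len-rest = ℕ.+-cancelˡ-≤ M _ _ (ℕ.≤-trans h (ℕ.≤-trans (ℕ.≤-reflexive (length-filter-∁ (R? x) xs))
    (ℕ.+-monoˡ-≤ _ (ℕ.≮⇒≥ M≮))))
...   | inj₁ (y , y∈ , M<) = inj₁ (y , there (proj₁ (∈-filter⁻ (¬? ∘ R? x) y∈)) ,
          ℕ.<-≤-trans M< (length-filter-mono (R? y) (x ∷ʳ filter-⊆ _ xs)))
...   | inj₂ (ys , t≤ , ys∈ , SRys) = inj₂ (x ∷ ys , s≤s t≤ ,
          here refl ∷ All.map (there ∘ proj₁ ∘ ∈-filter⁻ (¬? ∘ R? x)) ys∈ ,
          All.map (λ y∈ → let y∈xs , ¬Rxy = ∈-filter⁻ (¬? ∘ R? x) y∈ in All.lookup Sx y∈xs , ¬Rxy) ys∈ ∷ SRys)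

All⇒AllPairs : ∀ {P : A → Set} {xs} → All P xs → AllPairs (λ x y → P x × P y) xs
All⇒AllPairs []         = []
All⇒AllPairs (Px ∷ Pxs) = All.map (Px ,_) Pxs ∷ All⇒AllPairs Pxs

first-two : ∀ {R : A → A → Set} {P : A → Set} {xs} → AllPairs R xs → All P xs → 1 < length xs →
  ∃₂ λ x y → R x y × P x × P y
first-two ((Rxy ∷ _) ∷ _) (Px ∷ Py ∷ _) _ = _ , _ , Rxy , Px , Py
first-two (_ ∷ [])        _             (s≤s ())

AllPairs-lookup : ∀ {R : A → A → Set} {xs} → Symmetric R → AllPairs R xs →
  ∀ {i j} → i ≢ j → R (lookup xs i) (lookup xs j)
AllPairs-lookup R-sym (Rx ∷ Rxs) {zero}  {zero}  i≢j = contradiction refl i≢j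
AllPairs-lookup R-sym (Rx ∷ Rxs) {zero}  {suc j} i≢j = All.lookup Rx (∈-lookup j)
AllPairs-lookup R-sym (Rx ∷ Rxs) {suc i} {zero}  i≢j = R-sym (All.lookup Rx (∈-lookup i))
AllPairs-lookup R-sym (Rx ∷ Rxs) {suc i} {suc j} i≢j = AllPairs-lookup R-sym Rxs (i≢j ∘ cong suc)

lookup-injective : ∀ {xs : List A} → Unique xs → ∀ {i j} → lookup xs i ≡ lookup xs j → i ≡ j
lookup-injective u {i} {j} eq with i ≟ j
... | yes i≡j = i≡j
... | no  i≢j = contradiction eq (AllPairs-lookup (λ x≢y → x≢y ∘ ≡-sym) u i≢j)

without : Fin n → List (Fin n) → List (Fin n)
without i = filter (λ j → ¬? (j ≟ i))

∈-without : ∀ (i : Fin n) xs {j} → j ∈ without i xs → j ∈ xs × j ≢ i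
∈-without i xs = ∈-filter⁻ (λ j → ¬? (j ≟ i)) {xs = xs}

without-unique : ∀ {i : Fin n} {xs} → Unique xs → Unique (without i xs)
without-unique {i = i} = AllPairs.filter⁺ (λ j → ¬? (j ≟ i))

length-without : ∀ (i : Fin n) {xs} → Unique xs → length xs ≤ suc (length (without i xs))
length-without i {[]} _ = z≤n
length-without i {x ∷ xs} (x∉xs ∷ u) with x ≟ i
... | yes refl = s≤s (ℕ.≤-reflexive (cong length (≡-sym (filter-all _ (All.map (λ x≢y → x≢y ∘ ≡-sym) x∉xs)))))
... | no  _    = s≤s (length-without i u)

-- The default `d` makes the choice a total function of its parameters, so it can be composed with a
-- colouring before the pigeonhole principle is applied.
choose : ∀ {P : Fin n → Set} → Decidable P → Fin n → Fin n
choose P? d with any? P?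
... | yes (x , _) = x
... | no  _       = d

choose-sound : ∀ {P : Fin n → Set} (P? : Decidable P) d → ∃ P → P (choose P? d)
choose-sound P? d ∃P with any? P?
... | yes (_ , Px) = Px
... | no  ¬∃P      = contradiction ∃P ¬∃P

-- Finiteness of the set of graphs of bounded order.

symmetrise : (Fin n → Fin n → Bool) → Graph n
symmetrise b = record
  -- Requiring both entries and clearing the diagonal turns every Boolean matrix into a graph and
  -- leaves adjacency matrices unchanged.
  { adj    = λ u v → (b u v ∧ b v u) ∧ not (does (u ≟ v))
  ; sym    = λ u v → cong₂ _∧_ (Bool.∧-comm (b u v) (b v u)) (cong not (does-≟-comm u v))
  ; irrefl = λ v → trans (cong ((b v v ∧ b v v) ∧_) (cong not (does-≟-refl v))) (Bool.∧-zeroʳ _)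
  }
  where
  does-≟-refl : (v : Fin n) → does (v ≟ v) ≡ true
  does-≟-refl v with v ≟ v
  ... | yes _   = refl
  ... | no  v≢v = contradiction refl v≢v
  does-≟-comm : (u v : Fin n) → does (u ≟ v) ≡ does (v ≟ u)
  does-≟-comm u v with u ≟ v | v ≟ u
  ... | yes _   | yes _   = refl
  ... | no  _   | no  _   = refl
  ... | yes u≡v | no  v≢u = contradiction (≡-sym u≡v) v≢u
  ... | no  u≢v | yes v≡u = contradiction (≡-sym v≡u) u≢v

symmetrise-adj : (G : Graph n) (b : Fin n → Fin n → Bool) → (∀ u v → b u v ≡ adj G u v) →
  ∀ u v → adj G u v ≡ adj (symmetrise b) u v
symmetrise-adj G b b≗ u v rewrite b≗ u v | b≗ v u | sym G v u | Bool.∧-idem (adj G u v) with u ≟ v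
... | yes refl = trans (irrefl G u) (≡-sym (Bool.∧-zeroʳ _))
... | no  _    = ≡-sym (Bool.∧-identityʳ _)

decode : Fin (2 ^ (n * n)) → Graph n
decode c = symmetrise (λ u v → Inverse.to 2↔Bool (finToFun c (combine u v)))

encode : Graph n → Fin (2 ^ (n * n))
encode {n} G = funToFin (λ p → let u , v = remQuot {n} n p in Inverse.from 2↔Bool (adj G u v))

decode-encode : (G : Graph n) → ∀ u v → adj G u v ≡ adj (decode (encode G)) u v
decode-encode {n} G = symmetrise-adj G _ λ u v →
  trans (cong (Inverse.to 2↔Bool) (trans (finToFun-funToFin {n * n} _ (combine u v))
    (cong (λ (x , y) → Inverse.from 2↔Bool (adj G x y)) (remQuot-combine u v))))
  (Inverse.strictlyInverseˡ 2↔Bool (adj G u v))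

finitelyMany : ∀ {P : ∀ {n} → Graph n → Set} N →
  (∀ {n} (G : Graph n) → P G → n ≤ N) → FinitelyManyUpToIso P
finitelyMany N bounded = concatMap graphs (upTo (suc N)) , λ {n} G PG →
  lose (∈-concatMap⁺ graphs (lose (∈-upTo⁺ (s≤s (bounded G PG))) (∈-map⁺ _ (∈-allFin (encode G)))))
       (↔-id _ , decode-encode G)
  where
  graphs : ℕ → List (∃ Graph)
  graphs n = map (λ c → n , decode {n} c) (allFin _)

-- Embeddings as induced subgraphs.

record Embeds (H : Graph m) (G : Graph n) (f : Fin m → Fin n) : Set where
  constructor _,_
  field
    injective : Injective _≡_ _≡_ f
    preserves : ∀ u v → adj H u v ≡ adj G (f u) (f v)

Embeds⇒⊑ : ∀ {H : Graph m} {G : Graph n} {f} → Embeds H G f → H ⊑ G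
Embeds⇒⊑ (f-inj , f-pres) = mk↣ f-inj , ↔-id _ , f-pres

preserves-upper : ∀ {H : Graph m} {G : Graph n} (f : Fin m → Fin n) →
  (∀ u v → u Fin.< v → adj H u v ≡ adj G (f u) (f v)) →
  ∀ u v → adj H u v ≡ adj G (f u) (f v)
preserves-upper {H = H} {G} f upper u v with <-cmp u v
... | tri< u<v _ _ = upper u v u<v
... | tri≈ _ refl _ = trans (irrefl H u) (≡-sym (irrefl G (f u)))
... | tri> _ _ v<u = trans (sym H u v) (trans (upper v u v<u) (sym G (f v) (f u)))

-- A map that preserves adjacency and non-adjacency can only identify twins, so on a twin-free graph
-- it is injective. The co-gem and `path 5` are twin-free; the ends of `path 3` are twins, so its
-- embedding asks for `p ≢ r`.
TwinFree : Graph m → Set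
TwinFree H = ∀ u v → (∀ w → adj H u w ≡ adj H v w) → u ≡ v

twinFree? : (H : Graph m) → Dec (TwinFree H)
twinFree? H = all? λ u → all? λ v → (all? λ w → adj H u w Bool.≟ adj H v w) →-dec (u ≟ v)

TwinFree⇒Embeds : ∀ {H : Graph m} {G : Graph n} {f} → TwinFree H →
  (∀ u v → u Fin.< v → adj H u v ≡ adj G (f u) (f v)) → Embeds H G f
TwinFree⇒Embeds {H = H} {G} {f} twinFree upper =
  (λ {u} {v} fu≡fv → twinFree u v λ w →
    trans (pres u w) (trans (cong (λ x → adj G x (f w)) fu≡fv) (≡-sym (pres v w)))) , pres
  where pres = preserves-upper {H = H} {G} f upper

⊕-Embeds : ∀ {l} {H : Graph l} {K : Graph m} {G : Graph n} {f g} →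
  Embeds H G f → Embeds K G g → (∀ i j → adj G (f i) (g j) ≡ false) → (∀ i j → f i ≢ g j) →
  Embeds (H ⊕ K) G ([ f , g ]′ ∘ splitAt l)
⊕-Embeds {m} {l = l} {H} {K} {G} {f} {g} (f-inj , f-pres) (g-inj , g-pres) f≁g f≢g =
  (λ {u} {v} eq → trans (≡-sym (join-splitAt l m u))
    (trans (cong (join l m) (inj-⊎ (splitAt l u) (splitAt l v) eq)) (join-splitAt l m v))) , pres
  where
  inj-⊎ : ∀ s t → [ f , g ]′ s ≡ [ f , g ]′ t → s ≡ t
  inj-⊎ (inj₁ i) (inj₁ j) eq = cong inj₁ (f-inj eq)
  inj-⊎ (inj₁ i) (inj₂ j) eq = contradiction eq (f≢g i j)
  inj-⊎ (inj₂ i) (inj₁ j) eq = contradiction (≡-sym eq) (f≢g j i)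
  inj-⊎ (inj₂ i) (inj₂ j) eq = cong inj₂ (g-inj eq)
  pres : ∀ u v → adj (H ⊕ K) u v ≡ adj G ([ f , g ]′ (splitAt l u)) ([ f , g ]′ (splitAt l v))
  pres u v with splitAt l u | splitAt l v
  ... | inj₁ i | inj₁ j = f-pres i j
  ... | inj₁ i | inj₂ j = ≡-sym (f≁g i j)
  ... | inj₂ i | inj₁ j = trans (≡-sym (f≁g j i)) (sym G (f j) (g i))
  ... | inj₂ i | inj₂ j = g-pres i j

-- Such a `φ` would map `G` into `G -ᵥ a`, and composing it with a colouring there would colour `G`
-- with fewer than `k` colours.
no-proper-endomorphism : ∀ {k} (G : Graph n) → VertexCritical k G → (φ : Fin n → Fin n) (a : Fin n) →
  (∀ x → φ x ≢ a) → ¬ (∀ x y → adj G x y ≡ true → adj G (φ x) (φ y) ≡ true)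
no-proper-endomorphism {suc n} G ((_ , minimal) , critical) φ a φ≢a φ-hom with critical a
... | j , ((f , proper) , _) , j<k = ℕ.<⇒≱ j<k (minimal j ((λ x → f (ψ x)) , λ x y x~y →
        proper (ψ x) (ψ y) (trans (cong₂ (adj G) (punchIn-punchOut _) (punchIn-punchOut _)) (φ-hom x y x~y))))
  where
  ψ : Fin (suc n) → Fin n
  ψ x = punchOut (λ a≡ → φ≢a x (≡-sym a≡))

third : ∀ {t} → 3 ≤ t → (i j : Fin t) → ∃ λ l → l ≢ i × l ≢ j
third (s≤s (s≤s (s≤s _))) 0F      0F      = 1F , (λ ()) , (λ ())
third (s≤s (s≤s (s≤s _))) 0F      1F      = 2F , (λ ()) , (λ ())
third (s≤s (s≤s (s≤s _))) 0F      (suc (suc _)) = 1F , (λ ()) , (λ ())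
third (s≤s (s≤s (s≤s _))) 1F      0F      = 2F , (λ ()) , (λ ())
third (s≤s (s≤s (s≤s _))) (suc (suc _)) 0F      = 1F , (λ ()) , (λ ())
third (s≤s (s≤s (s≤s _))) (suc _) (suc _) = 0F , (λ ()) , (λ ())

five-upper : {P : Fin 5 → Fin 5 → Set} →
  P 0F 1F → P 0F 2F → P 0F 3F → P 0F 4F → P 1F 2F → P 1F 3F → P 1F 4F → P 2F 3F → P 2F 4F → P 3F 4F →
  ∀ u v → u Fin.< v → P u v
five-upper a _ _ _ _ _ _ _ _ _ 0F 1F _ = a
five-upper _ b _ _ _ _ _ _ _ _ 0F 2F _ = b
five-upper _ _ c _ _ _ _ _ _ _ 0F 3F _ = c
five-upper _ _ _ d _ _ _ _ _ _ 0F 4F _ = d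
five-upper _ _ _ _ e _ _ _ _ _ 1F 2F _ = e
five-upper _ _ _ _ _ f _ _ _ _ 1F 3F _ = f
five-upper _ _ _ _ _ _ g _ _ _ 1F 4F _ = g
five-upper _ _ _ _ _ _ _ h _ _ 2F 3F _ = h
five-upper _ _ _ _ _ _ _ _ i _ 2F 4F _ = i
five-upper _ _ _ _ _ _ _ _ _ j 3F 4F _ = j
five-upper _ _ _ _ _ _ _ _ _ _ 1F 1F (s≤s ())
five-upper _ _ _ _ _ _ _ _ _ _ 2F 1F (s≤s ())
five-upper _ _ _ _ _ _ _ _ _ _ 2F 2F (s≤s (s≤s ()))
five-upper _ _ _ _ _ _ _ _ _ _ 3F 1F (s≤s ())
five-upper _ _ _ _ _ _ _ _ _ _ 3F 2F (s≤s (s≤s ()))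
five-upper _ _ _ _ _ _ _ _ _ _ 3F 3F (s≤s (s≤s (s≤s ())))
five-upper _ _ _ _ _ _ _ _ _ _ 4F 1F (s≤s ())
five-upper _ _ _ _ _ _ _ _ _ _ 4F 2F (s≤s (s≤s ()))
five-upper _ _ _ _ _ _ _ _ _ _ 4F 3F (s≤s (s≤s (s≤s ())))
five-upper _ _ _ _ _ _ _ _ _ _ 4F 4F (s≤s (s≤s (s≤s (s≤s ()))))

-- Adjacency and small induced subgraphs in a fixed graph.

module Adjacency (G : Graph n) where

  infix 4 _~_ _≁_ _~?_ _≁?_

  _~_ _≁_ : Fin n → Fin n → Set
  x ~ y = adj G x y ≡ true
  x ≁ y = adj G x y ≡ false

  _~?_ : Decidable₂ _~_
  x ~? y = adj G x y Bool.≟ true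

  _≁?_ : Decidable₂ _≁_
  x ≁? y = adj G x y Bool.≟ false

  ~-sym : Symmetric _~_
  ~-sym {x} {y} = trans (sym G y x)

  ≁-sym : Symmetric _≁_
  ≁-sym {x} {y} = trans (sym G y x)

  ~⇒¬≁ : ∀ {x y} → x ~ y → ¬ x ≁ y
  ~⇒¬≁ x~y x≁y = case trans (≡-sym x~y) x≁y of λ ()

  ¬~⇒≁ : ∀ {x y} → ¬ x ~ y → x ≁ y
  ¬~⇒≁ = Bool.¬-not

  ¬≁⇒~ : ∀ {x y} → ¬ x ≁ y → x ~ y
  ¬≁⇒~ = Bool.¬-not

  separate : ∀ {x y z} → x ~ z → y ≁ z → x ≢ y
  separate x~z y≁z refl = ~⇒¬≁ x~z y≁z

  ~⇒≢ : ∀ {x y} → x ~ y → x ≢ y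
  ~⇒≢ {x} x~x refl = ~⇒¬≁ x~x (irrefl G x)

  coGem-⊑ : ∀ {p q r s z} → p ~ q → q ~ r → r ~ s → p ≁ r → p ≁ s → q ≁ s →
    p ≁ z → q ≁ z → r ≁ z → s ≁ z → coGem ⊑ G
  coGem-⊑ {p} {q} {r} {s} {z} pq qr rs pr ps qs pz qz rz sz =
    Embeds⇒⊑ (TwinFree⇒Embeds {H = coGem} {G} {lookup (p ∷ q ∷ r ∷ s ∷ z ∷ [])} (from-yes (twinFree? coGem))
      (five-upper (≡-sym pq) (≡-sym pr) (≡-sym ps) (≡-sym pz) (≡-sym qr)
        (≡-sym qs) (≡-sym qz) (≡-sym rs) (≡-sym rz) (≡-sym sz)))

  P₅-⊑ : ∀ {p q r s z} → p ~ q → q ~ r → r ~ s → s ~ z → p ≁ r → p ≁ s → q ≁ s →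
    p ≁ z → q ≁ z → r ≁ z → path 5 ⊑ G
  P₅-⊑ {p} {q} {r} {s} {z} pq qr rs sz pr ps qs pz qz rz =
    Embeds⇒⊑ (TwinFree⇒Embeds {H = path 5} {G} {lookup (p ∷ q ∷ r ∷ s ∷ z ∷ [])} (from-yes (twinFree? (path 5)))
      (five-upper (≡-sym pq) (≡-sym pr) (≡-sym ps) (≡-sym pz) (≡-sym qr)
        (≡-sym qs) (≡-sym qz) (≡-sym rs) (≡-sym rz) (≡-sym sz)))

  P₃-Embeds : ∀ {p q r} → p ~ q → q ~ r → p ≁ r → p ≢ r → Embeds (path 3) G (lookup (p ∷ q ∷ r ∷ []))
  P₃-Embeds {p} {q} {r} pq qr pr p≢r = lookup-injective
    ((~⇒≢ pq ∷ p≢r ∷ []) ∷ (~⇒≢ qr ∷ []) ∷ [] ∷ []) , preserves-upper {H = path 3} {G} _ upper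
    where
    f = lookup (p ∷ q ∷ r ∷ [])
    upper : ∀ u v → u Fin.< v → adj (path 3) u v ≡ adj G (f u) (f v)
    upper 0F 1F _ = ≡-sym pq
    upper 0F 2F _ = ≡-sym pr
    upper 1F 2F _ = ≡-sym qr
    upper 1F 1F (s≤s ())
    upper 2F 1F (s≤s ())
    upper 2F 2F (s≤s (s≤s ()))

-- Induced matchings and the cliques grown from their edges.

record InducedMatching (G : Graph n) (t : ℕ) : Set where
  open Adjacency G
  field
    e        : Fin t → Fin 2 → Fin n
    edge     : ∀ i → e i 0F ~ e i 1F
    separated : ∀ {i j} → i ≢ j → ∀ a b → e i a ≁ e j b

module Matching (c : ℕ) {G : Graph n} (free : Free ((_ , coGem) ∷ (_ , path 5) ∷ (_ , path 3 ⊕ c · path 2) ∷ []) G)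
  {t : ℕ} (M : InducedMatching G t) (t-large : 2 * (5 + c) ≤ t) where

  open Adjacency G
  open InducedMatching M

  no-coGem : ¬ coGem ⊑ G
  no-coGem = All.lookup free (here refl)

  no-P₅ : ¬ path 5 ⊑ G
  no-P₅ = All.lookup free (there (here refl))

  no-P₃+cP₂ : ¬ path 3 ⊕ c · path 2 ⊑ G
  no-P₃+cP₂ = All.lookup free (there (there (here refl)))

  partner : ∀ i a → ∃ λ b → e i a ~ e i b
  partner i 0F = 1F , edge i
  partner i 1F = 0F , ~-sym (edge i)

  _avoids_ : Fin n → List (Fin t) → Set
  x avoids js = All (λ j → ∀ a → x ≁ e j a) js

  -- Equality would make `x` adjacent to the other end of edge `j`. For the same reason ends of
  -- different matching edges are distinct.
  avoids⇒≢ : ∀ {x js j} → x avoids js → j ∈ js → ∀ a → x ≢ e j a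
  avoids⇒≢ {j = j} x-avoids j∈ a refl = let b , ab = partner j a in ~⇒¬≁ ab (All.lookup x-avoids j∈ b)

  edge-Embeds : ∀ i → Embeds (path 2) G (e i)
  edge-Embeds i = (λ {u} {v} → inj u v) , pres
    where
    inj : ∀ u v → e i u ≡ e i v → u ≡ v
    inj 0F 0F _ = refl
    inj 1F 1F _ = refl
    inj 0F 1F eq = contradiction eq (~⇒≢ (edge i))
    inj 1F 0F eq = contradiction (≡-sym eq) (~⇒≢ (edge i))
    pres : ∀ u v → adj (path 2) u v ≡ adj G (e i u) (e i v)
    pres 0F 0F = ≡-sym (irrefl G _)
    pres 1F 1F = ≡-sym (irrefl G _)
    pres 0F 1F = ≡-sym (edge i)
    pres 1F 0F = ≡-sym (~-sym (edge i))

  -- The last component locates the image among the edges in `js`, so that avoiding `js` implies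
  -- being disjoint from the image and non-adjacent to it.
  ·P₂-Embeds : ∀ c js → Unique js → c ≤ length js →
    ∃ λ g → Embeds (c · path 2) G g × (∀ x → ∃₂ λ j a → j ∈ js × g x ≡ e j a)
  ·P₂-Embeds zero    js _ _ = (λ ()) , ((λ {}) , λ ()) , λ ()
  ·P₂-Embeds (suc c) (j ∷ js) (j∉js ∷ u) (s≤s c≤) with ·P₂-Embeds c js u c≤
  ... | g , g-emb , g∈ = [ e j , g ]′ ∘ splitAt 2 ,
          ⊕-Embeds {H = path 2} {c · path 2} {G} (edge-Embeds j) g-emb e≁g e≢g , image
    where
    ej-avoids : ∀ a → e j a avoids js
    ej-avoids a = All.map (λ j≢i → separated j≢i a) j∉js
    e≁g : ∀ a x → e j a ≁ g x
    e≁g a x with g∈ x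
    ... | i , b , i∈ , eq rewrite eq = All.lookup (ej-avoids a) i∈ b
    e≢g : ∀ a x → e j a ≢ g x
    e≢g a x with g∈ x
    ... | i , b , i∈ , eq rewrite eq = avoids⇒≢ (ej-avoids a) i∈ b
    image : ∀ x → ∃₂ λ i a → i ∈ j ∷ js × [ e j , g ]′ (splitAt 2 x) ≡ e i a
    image x with splitAt 2 x
    ... | inj₁ a = j , a , here refl , refl
    ... | inj₂ y = let i , a , i∈ , eq = g∈ y in i , a , there i∈ , eq

  -- Together with `c` edges from `js`, the three vertices would induce the forbidden
  -- `path 3 ⊕ c · path 2`.
  P₃-meets : ∀ {x y z} → x ~ y → y ~ z → x ≁ z → x ≢ z → ∀ {js} → Unique js → c ≤ length js →
    x avoids js → y avoids js → z avoids js → ⊥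
  P₃-meets {x} {y} {z} xy yz x≁z x≢z {js} u c≤ x-av y-av z-av =
    let g , g-emb , g∈ = ·P₂-Embeds c js u c≤ in
    no-P₃+cP₂ (Embeds⇒⊑ (⊕-Embeds {H = path 3} {c · path 2} {G} (P₃-Embeds xy yz x≁z x≢z) g-emb
      (λ a w → let j , b , j∈ , eq = g∈ w in trans (cong (adj G _) eq) (All.lookup (P-av a) j∈ b))
      (λ a w eq′ → let j , b , j∈ , eq = g∈ w in avoids⇒≢ (P-av a) j∈ b (trans eq′ eq))))
    where
    P-av : ∀ a → lookup (x ∷ y ∷ z ∷ []) a avoids js
    P-av 0F = x-av
    P-av 1F = y-av
    P-av 2F = z-av

  5+c≤t : 5 + c ≤ t
  5+c≤t = ℕ.≤-trans (ℕ.m≤m+n _ _) t-large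

  3≤t : 3 ≤ t
  3≤t = ℕ.≤-trans (s≤s (s≤s (s≤s z≤n))) 5+c≤t

  others : Fin t → List (Fin t)
  others i = without i (allFin t)

  others-unique : ∀ i → Unique (others i)
  others-unique i = without-unique (allFin⁺ t)

  c≤others : ∀ i → c ≤ length (others i)
  c≤others i = ℕ.≤-trans (ℕ.m≤n+m c 4) (s≤s⁻¹ (ℕ.≤-trans 5+c≤t
    (ℕ.≤-trans (ℕ.≤-reflexive (≡-sym (length-tabulate id))) (length-without i (allFin⁺ t)))))

  others-avoid : ∀ {x i} → (∀ j → j ≢ i → ∀ a → x ≁ e j a) → x avoids others i
  others-avoid x≁ = All.tabulate λ j∈ → x≁ _ (proj₂ (∈-without _ (allFin t) j∈))

  -- The private neighbours of an edge are added to it, which absorbs the vertices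
  -- that would otherwise see a single edge of the matching.
  C : Fin t → Fin n → Set
  C i x = (∃ λ a → x ≡ e i a) ⊎ ((∀ a → x ~ e i a) × (∀ j → j ≢ i → ∀ a → x ≁ e j a))

  C? : ∀ i → Decidable (C i)
  C? i x = any? (λ a → x ≟ e i a) ⊎-dec
    (all? (λ a → x ~? e i a) ×-dec all? (λ j → ¬? (j ≟ i) →-dec all? (λ a → x ≁? e j a)))

  e∈C : ∀ i a → C i (e i a)
  e∈C i a = inj₁ (a , refl)

  C-separated : ∀ {i j x y} → i ≢ j → C i x → C j y → x ≁ y
  C-separated i≢j (inj₁ (a , refl)) (inj₁ (b , refl)) = separated i≢j a b
  C-separated i≢j (inj₁ (a , refl)) (inj₂ (_ , y≁)) = ≁-sym (y≁ _ i≢j a)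
  C-separated i≢j (inj₂ (_ , x≁)) (inj₁ (b , refl)) = x≁ _ (i≢j ∘ ≡-sym) b
  C-separated {i} {j} i≢j (inj₂ (x~ , x≁)) (inj₂ (y~ , y≁)) = ¬~⇒≁ λ x~y →
    let l , l≢i , l≢j = third 3≤t i j in
    -- The path is `e i 0F`, `x`, `y`, `e j 0F`; an end of a third edge `l` is the isolated vertex.
    no-coGem (coGem-⊑ {z = e l 0F} (~-sym (x~ 0F)) x~y (y~ 0F) (≁-sym (y≁ i i≢j 0F)) (separated i≢j 0F 0F)
      (x≁ j (i≢j ∘ ≡-sym) 0F) (separated (l≢i ∘ ≡-sym) 0F 0F) (x≁ l l≢i 0F) (y≁ l l≢j 0F)
      (separated (l≢j ∘ ≡-sym) 0F 0F))

  C-neighbour : ∀ {i x} → C i x → ∃ λ a → x ~ e i a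
  C-neighbour {i} (inj₁ (a , refl)) = partner i a
  C-neighbour     (inj₂ (x~ , _))   = 0F , x~ 0F

  C-disjoint : ∀ {i j x y} → i ≢ j → C i x → C j y → x ≢ y
  C-disjoint {i} i≢j x∈ y∈ = let a , x~ = C-neighbour x∈ in
    separate x~ (≁-sym (C-separated i≢j (e∈C i a) y∈))

  C-avoids-edges : ∀ {i x} → C i x → ∀ j → j ≢ i → ∀ a → x ≁ e j a
  C-avoids-edges x∈ j j≢i a = C-separated (j≢i ∘ ≡-sym) x∈ (e∈C j a)

  C-clique : ∀ {i x y} → C i x → C i y → x ≢ y → x ~ y
  C-clique {i} (inj₁ (a , refl)) (inj₁ (b , refl)) x≢y with a | b
  ... | 0F | 0F = contradiction refl x≢y
  ... | 0F | 1F = edge i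
  ... | 1F | 0F = ~-sym (edge i)
  ... | 1F | 1F = contradiction refl x≢y
  C-clique (inj₁ (a , refl)) (inj₂ (y~ , _)) _ = ~-sym (y~ a)
  C-clique (inj₂ (x~ , _)) (inj₁ (b , refl)) _ = x~ b
  C-clique {i} (inj₂ (x~ , x≁)) (inj₂ (y~ , y≁)) x≢y = ¬≁⇒~ λ x≁y →
    -- Two non-adjacent private neighbours of edge `i` form an induced path with `e i 0F` in the
    -- middle, and all other edges are avoided.
    P₃-meets (x~ 0F) (~-sym (y~ 0F)) x≁y x≢y (others-unique i) (c≤others i)
      (others-avoid x≁) (others-avoid (C-avoids-edges (e∈C i 0F))) (others-avoid y≁)

  -- Vertices outside the cliques that have neighbours in them.

  Misses : Fin n → Fin t → Set
  Misses w l = ∃ λ y → C l y × w ≁ y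

  Misses? : ∀ w → Decidable (Misses w)
  Misses? w l = any? λ y → C? l y ×-dec (w ≁? y)

  ¬Misses⇒complete : ∀ {w l} → ¬ Misses w l → ∀ {y} → C l y → w ~ y
  ¬Misses⇒complete ¬miss y∈ = ¬≁⇒~ λ w≁y → ¬miss (_ , y∈ , w≁y)

  Outer : Fin n → Set
  Outer w = (∀ l → ¬ C l w) × ∃₂ λ i x → C i x × w ~ x

  Outer? : Decidable Outer
  Outer? w = all? (λ l → ¬? (C? l w)) ×-dec any? (λ i → any? λ x → C? i x ×-dec (w ~? x))

  -- Otherwise `w` sees no other clique. If it sees both ends of edge `i`, it is a private neighbour
  -- and lies in `C i`; if it misses `e i a`, then `w`, `x`, `e i a` is an induced path avoiding all
  -- other edges.
  sees-two : ∀ {w i x} → ¬ C i w → C i x → w ~ x → ∃₂ λ j y → j ≢ i × C j y × w ~ y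
  sees-two {w} {i} {x} w∉ x∈ w~x with any? (λ j → ¬? (j ≟ i) ×-dec any? (λ y → C? j y ×-dec (w ~? y)))
  ... | yes (j , j≢i , y , y∈ , w~y) = j , y , j≢i , y∈ , w~y
  ... | no none = ⊥-elim (w∉ (inj₂ (w~e , λ j j≢i a → w≁ j j≢i a)))
    where
    w≁ : ∀ j → j ≢ i → ∀ a → w ≁ e j a
    w≁ j j≢i a = ¬~⇒≁ λ w~ → none (j , j≢i , e j a , e∈C j a , w~)
    w~e : ∀ a → w ~ e i a
    w~e a = ¬≁⇒~ λ w≁e → P₃-meets w~x (C-clique x∈ (e∈C i a) (separate (~-sym w~x) (≁-sym w≁e))) w≁e
      (λ { refl → w∉ (e∈C i a) }) (others-unique i) (c≤others i)
      (others-avoid w≁) (others-avoid (C-avoids-edges x∈)) (others-avoid (C-avoids-edges (e∈C i a)))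

  -- Setting aside the cliques `i` and `j` of two neighbours `x`, `x′` of `w` leaves at least
  -- `3 + c` missed cliques: enough for `c` edges avoided by the path `x`, `w`, `x′`, and for the
  -- two cliques used in a co-gem.
  Outer-misses-few : ∀ {w} → Outer w → ∀ {L} → Unique L → All (Misses w) L → length L < 5 + c
  Outer-misses-few {w} (w∉ , i , x , x∈ , w~x) {L} L-unique misses with sees-two (w∉ i) x∈ w~x
  ... | j , x′ , j≢i , x′∈ , w~x′ = ℕ.≰⇒> impossible
    where
    L′ = without j (without i L)
    L′-unique : Unique L′
    L′-unique = without-unique (without-unique L-unique)
    from-L′ : ∀ {l} → l ∈ L′ → l ∈ L × l ≢ i × l ≢ j
    from-L′ l∈ = let l∈₁ , l≢j = ∈-without j (without i L) l∈ ; l∈L , l≢i = ∈-without i L l∈₁ in l∈L , l≢i , l≢j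
    3+c≤ : 5 + c ≤ length L → 3 + c ≤ length L′
    3+c≤ h = s≤s⁻¹ (s≤s⁻¹ (ℕ.≤-trans h (ℕ.≤-trans (length-without i L-unique)
      (s≤s (length-without j (without-unique L-unique))))))
    impossible : ¬ 5 + c ≤ length L
    -- If `w` sees no end of the remaining edges, `x`, `w`, `x′` and `c` of these edges are
    -- forbidden. If it sees `e l a`, it still misses some `y` in `C l`, which gives the induced
    -- path `y`, `e l a`, `w`, `x`.
    impossible 5+c≤ with Any.any? (λ l → any? (λ a → w ~? e l a)) L′
    ... | no none = P₃-meets (~-sym w~x) w~x′ (C-separated (j≢i ∘ ≡-sym) x∈ x′∈)
            (C-disjoint (j≢i ∘ ≡-sym) x∈ x′∈) L′-unique (ℕ.≤-trans (ℕ.m≤n+m c 3) (3+c≤ 5+c≤))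
            (All.tabulate λ l∈ → C-avoids-edges x∈ _ (proj₁ (proj₂ (from-L′ l∈))))
            (All.map (λ ¬~ a → ¬~⇒≁ λ w~ → ¬~ (a , w~)) (All.¬Any⇒All¬ _ none))
            (All.tabulate λ l∈ → C-avoids-edges x′∈ _ (proj₂ (proj₂ (from-L′ l∈))))
    ... | yes some with find some
    -- A second missed clique `l′` supplies the isolated vertex `z` of the co-gem.
    ...   | l , l∈ , a , w~e with without l L′ in eq | ℕ.≤-trans (3+c≤ 5+c≤) (length-without l L′-unique)
    ...     | []     | s≤s ()
    ...     | l′ ∷ _ | _ =
      let l∈L , l≢i , _ = from-L′ l∈
          l′∈L′ , l′≢l = ∈-without l L′ (subst (l′ ∈_) (≡-sym eq) (here refl))
          l′∈L , l′≢i , _ = from-L′ l′∈L′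
          y , y∈ , w≁y = All.lookup misses l∈L
          z , z∈ , w≁z = All.lookup misses l′∈L
      in no-coGem (coGem-⊑ (~-sym (C-clique (e∈C l a) y∈ (separate (~-sym w~e) (≁-sym w≁y)))) (~-sym w~e) w~x
           (≁-sym w≁y) (C-separated l≢i y∈ x∈) (C-separated l≢i (e∈C l a) x∈)
           (C-separated (l′≢l ∘ ≡-sym) y∈ z∈) (C-separated (l′≢l ∘ ≡-sym) (e∈C l a) z∈) w≁z
           (C-separated (l′≢i ∘ ≡-sym) x∈ z∈))

  -- Each of the two vertices misses fewer than `5 + c` cliques, and `t` is at least twice that.
  commonly-complete : ∀ {w w′} → Outer w → Outer w′ → ∃ λ l → ¬ Misses w l × ¬ Misses w′ l
  commonly-complete {w} {w′} Ow Ow′ with any? (λ l → ¬? (Misses? w l) ×-dec ¬? (Misses? w′ l))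
  ... | yes found = found
  ... | no  none  = contradiction t-large (ℕ.<⇒≱ (begin-strict
    t                                         ≡⟨ length-tabulate id ⟨
    length (allFin t)                         ≡⟨ length-filter-∁ (Misses? w) (allFin t) ⟩
    length missed + length rest               <⟨ ℕ.+-mono-<
      (Outer-misses-few Ow (AllPairs.filter⁺ _ (allFin⁺ t)) (All.all-filter (Misses? w) (allFin t)))
      (Outer-misses-few Ow′ (AllPairs.filter⁺ _ (allFin⁺ t))
        (All.map (λ {l} ¬miss → decidable-stable (Misses? w′ l) λ ¬miss′ → none (l , ¬miss , ¬miss′))
          (All.all-filter (¬? ∘ Misses? w) (allFin t)))) ⟩
    5 + c + (5 + c)                           ≡⟨ cong (5 + c +_) (ℕ.+-identityʳ _) ⟨
    2 * (5 + c)                               ∎))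
    where
    open ℕ.≤-Reasoning
    missed = filter (Misses? w) (allFin t)
    rest   = filter (¬? ∘ Misses? w) (allFin t)

  -- Suppose `w` is complete to `C l`, and let `p` index a clique complete to both vertices. Then
  -- `z`, `w`, `e p 0F`, `w′` is an induced path. The vertex `y` extends it to `path 5` if adjacent
  -- to `w′`, and is the isolated vertex of a co-gem otherwise.
  Outer-comparable : ∀ {w w′ j l} → Outer w → Outer w′ → w ≁ w′ →
    Misses w j → Misses w′ l → j ≢ l → Misses w l
  Outer-comparable {w} {w′} {j} {l} Ow Ow′ w≁w′ (y , y∈ , w≁y) (z , z∈ , w′≁z) j≢l =
    decidable-stable (Misses? w l) λ ¬miss →
    let p , w-full , w′-full = commonly-complete Ow Ow′
        w~z = ¬Misses⇒complete ¬miss z∈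
        w~p = ¬Misses⇒complete w-full (e∈C p 0F)
        w′~p = ¬Misses⇒complete w′-full (e∈C p 0F)
        p≁y = C-separated (λ p≡j → w-full (subst (Misses w) (≡-sym p≡j) (y , y∈ , w≁y))) (e∈C p 0F) y∈
        p≁z = C-separated (λ p≡l → w′-full (subst (Misses w′) (≡-sym p≡l) (z , z∈ , w′≁z))) (e∈C p 0F) z∈
        z≁y = C-separated (j≢l ∘ ≡-sym) z∈ y∈
    in case w′ ~? y of λ where
      (yes w′~y) → no-P₅ (P₅-⊑ (~-sym w~z) w~p (~-sym w′~p) w′~y
        (≁-sym p≁z) (≁-sym w′≁z) w≁w′ z≁y w≁y p≁y)
      (no w′≁y) → no-coGem (coGem-⊑ (~-sym w~z) w~p (~-sym w′~p)
        (≁-sym p≁z) (≁-sym w′≁z) w≁w′ z≁y w≁y p≁y (¬~⇒≁ w′≁y))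

-- The first summand ensures that any two outer vertices are complete to a common clique; the second
-- leaves two cliques after up to `k * (5 + c)` bad ones are discarded.
matchingBound : ℕ → ℕ → ℕ
matchingBound k c = 2 * (5 + c) + suc (suc (k * (5 + c)))

-- d is the number of vertices by which a clique is still to be extended.
independenceBound : ℕ → ℕ → ℕ → ℕ
independenceBound k c zero    = 0
independenceBound k c (suc d) = suc (k * (matchingBound k c * suc (independenceBound k c d)))

-- Critical graphs: colour classes, cliques and neighbourhoods.

module Critical {k c : ℕ} {G : Graph n} (critical : VertexCritical k G)
  (free : Free ((_ , coGem) ∷ (_ , path 5) ∷ (_ , path 3 ⊕ c · path 2) ∷ []) G) where

  open Adjacency G

  colour : Fin n → Fin k
  colour = proj₁ (proj₁ (proj₁ critical))

  monochromatic⇒≁ : ∀ {x y} → colour x ≡ colour y → x ≁ y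
  monochromatic⇒≁ eq = ¬~⇒≁ λ x~y → proj₂ (proj₁ (proj₁ critical)) _ _ x~y eq

  clique-bounded : ∀ {Q} → AllPairs _~_ Q → length Q ≤ k
  clique-bounded {Q} clique = ℕ.≮⇒≥ λ k< →
    let p , 1< = popular-value colour 1 Q (subst (_< length Q) (≡-sym (ℕ.*-identityʳ k)) k<)
        x , y , x~y , x-p , y-p = first-two (AllPairs.filter⁺ _ clique) (All.all-filter _ Q) 1<
    in ~⇒¬≁ x~y (monochromatic⇒≁ (trans x-p (≡-sym y-p)))

  -- If every neighbour of `b` were a neighbour of `r`, sending `b` to `r` and fixing all else would
  -- be an endomorphism missing `b`.
  incomparable : ∀ {b r} → b ≁ r → b ≢ r → ∃ λ u → u ~ b × u ≁ r
  incomparable {b} {r} b≁r b≢r with any? (λ u → u ~? b ×-dec u ≁? r)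
  ... | yes found = found
  ... | no  none  = contradiction φ-hom (no-proper-endomorphism G critical φ b φ≢b)
    where
    N[b]⊆N[r] : ∀ {u} → u ~ b → u ~ r
    N[b]⊆N[r] u~b = ¬≁⇒~ λ u≁r → none (_ , u~b , u≁r)
    φ : Fin n → Fin n
    φ x with x ≟ b
    ... | yes _ = r
    ... | no  _ = x
    φ≢b : ∀ x → φ x ≢ b
    φ≢b x with x ≟ b
    ... | yes _   = b≢r ∘ ≡-sym
    ... | no  x≢b = x≢b
    φ-hom : ∀ x y → x ~ y → φ x ~ φ y
    φ-hom x y x~y with x ≟ b | y ≟ b
    ... | yes refl | yes refl = contradiction refl (~⇒≢ x~y)
    ... | yes refl | no  _    = ~-sym (N[b]⊆N[r] (~-sym x~y))
    ... | no  _    | yes refl = N[b]⊆N[r] x~y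
    ... | no  _    | no  _    = x~y

  -- Bounding induced matchings by clique absorption.

  module _ {t} (M : InducedMatching G t) (t-large : matchingBound k c ≤ t) where

    open InducedMatching M
    open Matching c free M (ℕ.≤-trans (ℕ.m≤m+n _ _) t-large)

    Bad : Fin t → Fin n → Set
    Bad j w = Outer w × Misses w j

    Bad? : ∀ j → Decidable (Bad j)
    Bad? j w = Outer? w ×-dec Misses? w j

    bad good : List (Fin t)
    bad  = filter (λ j → any? (Bad? j)) (allFin t)
    good = filter (λ j → ¬? (any? (Bad? j))) (allFin t)

    -- Give each bad clique an outer vertex missing it. Among too many bad cliques, more than
    -- `5 + c` of these vertices have one colour, so they are pairwise non-adjacent or equal.
    few-bad : length bad ≤ k * (5 + c)
    few-bad = ℕ.≮⇒≥ λ many →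
      let p , B< = popular-value (colour ∘ culprit) (5 + c) bad many
      in impossible (AllPairs.filter⁺ _ (AllPairs.filter⁺ _ (allFin⁺ t)))
           (All.zip (All.filter⁺ _ (All.all-filter _ (allFin t)) , All.all-filter _ bad)) B<
      where
      culprit : Fin t → Fin n
      culprit j = choose (Bad? j) (e j 0F)
      impossible : ∀ {p js} → Unique js → All (λ j → ∃ (Bad j) × colour (culprit j) ≡ p) js → ¬ 5 + c < length js
      -- By comparability the vertex chosen for `j` misses every clique in the tail, and the tail
      -- has at least `5 + c` members.
      impossible {js = j ∷ js} (j∉js ∷ u) ((bad-j , j-p) ∷ bad-js) (s≤s B≤) =
        let Oj , Mj = choose-sound (Bad? j) _ bad-j
        in ℕ.<⇒≱ (Outer-misses-few Oj u (All.zipWith (λ {l} (j≢l , bad-l , l-p) →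
             let Ol , Ml = choose-sound (Bad? l) _ bad-l
             in Outer-comparable Oj Ol (monochromatic⇒≁ (trans j-p (≡-sym l-p))) Mj Ml j≢l) (j∉js , bad-js))) B≤

    two-good : 1 < length good
    two-good = ℕ.+-cancelˡ-≤ (k * (5 + c)) _ _ (begin
      k * (5 + c) + 2               ≡⟨ ℕ.+-comm _ 2 ⟩
      suc (suc (k * (5 + c)))       ≤⟨ ℕ.m≤n+m _ (2 * (5 + c)) ⟩
      matchingBound k c             ≤⟨ t-large ⟩
      t                             ≡⟨ length-tabulate id ⟨
      length (allFin t)             ≡⟨ length-filter-∁ _ (allFin t) ⟩
      length bad + length good      ≤⟨ ℕ.+-monoˡ-≤ _ few-bad ⟩
      k * (5 + c) + length good     ∎)
      where open ℕ.≤-Reasoning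

    members : Fin t → List (Fin n)
    members i = filter (C? i) (allFin n)

    -- Map `C i` injectively into `C j` and fix all other vertices. Edges inside `C i` survive since
    -- `C j` is a clique; edges leaving `C i` end in outer vertices, which are complete to `C j`
    -- because `j` is not bad. The vertex `e i 0F` is missed.
    no-absorption : ∀ {i j} → i ≢ j → ¬ ∃ (Bad j) → ¬ length (members i) ≤ length (members j)
    no-absorption {i} {j} i≢j ¬bad i≤j =
      no-proper-endomorphism G critical φ (e i 0F) φ≢e φ-hom
      where
      transfer : ∀ {x} → C i x → Fin n
      transfer {x} x∈ = lookup (members j) (inject≤ (Any.index (∈-filter⁺ (C? i) (∈-allFin x) x∈)) i≤j)
      transfer∈ : ∀ {x} (x∈ : C i x) → C j (transfer x∈)
      transfer∈ _ = proj₂ (∈-filter⁻ (C? j) {xs = allFin n} (∈-lookup _))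
      transfer-injective : ∀ {x y} (x∈ : C i x) (y∈ : C i y) → transfer x∈ ≡ transfer y∈ → x ≡ y
      transfer-injective {x} {y} x∈ y∈ eq = begin
        x                                       ≡⟨ Any.lookup-index x∈ᵢ ⟩
        lookup (members i) (Any.index x∈ᵢ)      ≡⟨ cong (lookup (members i)) (inject≤-injective i≤j i≤j _ _
          (lookup-injective (AllPairs.filter⁺ (C? j) (allFin⁺ n)) eq)) ⟩
        lookup (members i) (Any.index y∈ᵢ)      ≡⟨ Any.lookup-index y∈ᵢ ⟨
        y                                       ∎
        where
        open ≡-Reasoning
        x∈ᵢ = ∈-filter⁺ (C? i) (∈-allFin x) x∈
        y∈ᵢ = ∈-filter⁺ (C? i) (∈-allFin y) y∈
      φ : Fin n → Fin n
      φ x with C? i x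
      ... | yes x∈ = transfer x∈
      ... | no  _  = x
      φ≢e : ∀ x → φ x ≢ e i 0F
      φ≢e x with C? i x
      ... | yes x∈ = C-disjoint (i≢j ∘ ≡-sym) (transfer∈ x∈) (e∈C i 0F)
      ... | no  x∉ = λ { refl → x∉ (e∈C i 0F) }
      leaves : ∀ {x y} → C i x → ¬ C i y → x ~ y → Outer y
      leaves {x} {y} x∈ y∉ x~y = (λ l y∈ → case i ≟ l of λ where
          (yes refl) → y∉ y∈
          (no  i≢l)  → ~⇒¬≁ x~y (C-separated i≢l x∈ y∈)) , i , x , x∈ , ~-sym x~y
      outer~transfer : ∀ {x y} (x∈ : C i x) → ¬ C i y → x ~ y → y ~ transfer x∈
      outer~transfer x∈ y∉ x~y = ¬Misses⇒complete (λ miss → ¬bad (_ , leaves x∈ y∉ x~y , miss)) (transfer∈ x∈)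
      φ-hom : ∀ x y → x ~ y → φ x ~ φ y
      φ-hom x y x~y with C? i x | C? i y
      ... | yes x∈ | yes y∈ = C-clique (transfer∈ x∈) (transfer∈ y∈) (~⇒≢ x~y ∘ transfer-injective x∈ y∈)
      ... | yes x∈ | no  y∉ = ~-sym (outer~transfer x∈ y∉ x~y)
      ... | no  x∉ | yes y∈ = outer~transfer y∈ x∉ (~-sym x~y)
      ... | no  _  | no  _  = x~y

    matching-bounded : ⊥
    matching-bounded =
      let i , j , i≢j , i-good , j-good = first-two (AllPairs.filter⁺ _ (allFin⁺ t)) (All.all-filter _ (allFin t)) two-good
      in [ no-absorption i≢j j-good , no-absorption (i≢j ∘ ≡-sym) i-good ]′ (ℕ.≤-total _ _)

  -- Bounding independent sets.

  Apart : Fin n → Fin n → Set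
  Apart x y = x ≁ y × x ≢ y

  -- The witness `s` is the vertex `r` fixed in the round that chose `q`. It stays non-adjacent to
  -- the shrinking `I` and forces later choices to be adjacent to `q`.
  Partial : List (Fin n) → Fin n → Set
  Partial I q = All (q ~_) I × ∃ λ s → s ≁ q × All (s ≁_) I

  -- Induction on the number `d` of rounds left: each round adds one vertex to the clique `Q` and
  -- shrinks `I` to its neighbours. At `d` equal to zero, `Q` would be a clique on `k + 1` vertices.
  independent-bounded : ∀ d Q I → AllPairs _~_ Q → length Q + d ≡ suc k → AllPairs Apart I →
    All (Partial I) Q → ¬ independenceBound k c d < length I
  independent-bounded zero Q I clique |Q| _ _ _ =
    contradiction (clique-bounded clique) (ℕ.<⇒≱ (ℕ.≤-reflexive (trans (≡-sym |Q|) (ℕ.+-identityʳ _))))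
  independent-bounded (suc d) Q (r ∷ I) clique |Q| (r-apart ∷ apart) partial (s≤s large) =
    [ extend , match ]′ (greedy (λ b b′ → U b ~? b′) bound (matchingBound k c) J (AllPairs.filter⁺ _ apart) (ℕ.<⇒≤ J-large))
    where
    bound = independenceBound k c d

    U : Fin n → Fin n
    U b = choose (λ u → u ~? b ×-dec u ≁? r) b

    pop : ∃ λ p → matchingBound k c * suc bound < length (filter (λ b → colour (U b) ≟ p) I)
    pop = popular-value (colour ∘ U) _ I large

    J : List (Fin n)
    J = filter (λ b → colour (U b) ≟ proj₁ pop) I

    J-large = proj₂ pop

    Link : Fin n → Set
    Link b = r ≁ b × U b ~ b × U b ≁ r × colour (U b) ≡ proj₁ pop

    J⊆I : ∀ {b} → b ∈ J → b ∈ I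
    J⊆I b∈ = proj₁ (∈-filter⁻ (λ b → colour (U b) ≟ proj₁ pop) {xs = I} b∈)

    link : ∀ {b} → b ∈ J → Link b
    link {b} b∈ =
      let b∈I , col = ∈-filter⁻ (λ b → colour (U b) ≟ proj₁ pop) {xs = I} b∈
          r≁b , r≢b = All.lookup r-apart b∈I
          U~b , U≁r = choose-sound (λ u → u ~? b ×-dec u ≁? r) b (incomparable (≁-sym r≁b) (r≢b ∘ ≡-sym))
      in r≁b , U~b , U≁r , col

    extend : ¬ ∃ λ b → b ∈ J × bound < length (filter (λ b′ → U b ~? b′) J)
    extend (b , b∈ , K-large) = independent-bounded d (U b ∷ Q) K
      (All.map U~q partial ∷ clique) (trans (≡-sym (ℕ.+-suc _ _)) |Q|)
      (AllPairs.filter⁺ _ (AllPairs.filter⁺ _ apart))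
      ((All.all-filter _ J , r , ≁-sym U≁r , restrict (All.map proj₁ r-apart)) ∷
        All.map (λ { (_ ∷ q~I , s , s≁q , _ ∷ s≁I) → restrict q~I , s , s≁q , restrict s≁I }) partial)
      K-large
      where
      K = filter (λ b′ → U b ~? b′) J
      restrict : ∀ {P : Fin n → Set} → All P I → All P K
      restrict = All.filter⁺ _ ∘ All.filter⁺ _
      U~b = proj₁ (proj₂ (link b∈))
      U≁r = proj₁ (proj₂ (proj₂ (link b∈)))
      -- Otherwise `U b`, `b`, `q`, `r` is an induced path. The witness `s` of `q` is non-adjacent
      -- to `b`, `q` and `r`, so it extends the path to `path 5` if adjacent to `U b`, and completes
      -- a co-gem if not.
      U~q : ∀ {q} → Partial (r ∷ I) q → U b ~ q
      U~q {q} (q~r ∷ q~I , s , s≁q , s≁r ∷ s≁I) = ¬≁⇒~ λ U≁q →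
        let q~b = All.lookup q~I (J⊆I b∈)
            s≁b = All.lookup s≁I (J⊆I b∈)
            b≁r = ≁-sym (proj₁ (link b∈))
        in case s ~? U b of λ where
          (yes s~U) → All.lookup free (there (here refl)) (P₅-⊑ s~U U~b (~-sym q~b) q~r s≁b s≁q U≁q s≁r U≁r b≁r)
          (no  s≁U) → All.lookup free (here refl) (coGem-⊑ U~b (~-sym q~b) q~r U≁q U≁r b≁r
            (≁-sym (¬~⇒≁ s≁U)) (≁-sym s≁b) (≁-sym s≁q) (≁-sym s≁r))

    Separate : Fin n → Fin n → Set
    Separate b b′ = b ≁ b′ × U b ≁ U b′ × U b ≁ b′ × U b′ ≁ b

    Separate-sym : Symmetric Separate
    Separate-sym (bb′ , UU′ , Ub′ , U′b) = ≁-sym bb′ , ≁-sym UU′ , U′b , Ub′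

    separate-pair : ∀ {b b′} → (Link b × Link b′) × Apart b b′ × ¬ U b ~ b′ → Separate b b′
    separate-pair {b} {b′} (((r≁b , U~b , U≁r , col) , (r≁b′ , U′~b′ , U′≁r , col′)) , (b≁b′ , _) , ¬U~b′) =
      -- The greedy selection gives only `U b ≁ b′`. For the reverse, `U b′ ~ b` would make `U b`,
      -- `b`, `U b′`, `b′` an induced path with `r` isolated from it.
      b≁b′ , U≁U′ , U≁b′ , ¬~⇒≁ λ U′~b → All.lookup free (here refl)
        (coGem-⊑ U~b (~-sym U′~b) U′~b′ U≁U′ U≁b′ b≁b′ U≁r (≁-sym r≁b) U′≁r (≁-sym r≁b′))
      where
      U≁U′ = monochromatic⇒≁ (trans col (≡-sym col′))
      U≁b′ = ¬~⇒≁ ¬U~b′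

    match : ¬ ∃ λ ys → matchingBound k c ≤ length ys × All (_∈ J) ys × AllPairs (λ x y → Apart x y × ¬ U x ~ y) ys
    match (ys , ys-large , ys∈ , pairs) = matching-bounded M ys-large
      where
      links : All Link ys
      links = All.map link ys∈
      separate-ys : AllPairs Separate ys
      separate-ys = AllPairs.zipWith separate-pair (All⇒AllPairs links , pairs)
      M : InducedMatching G (length ys)
      M = record
        { e = λ { i 0F → lookup ys i ; i 1F → U (lookup ys i) }
        ; edge = λ i → ~-sym (proj₁ (proj₂ (All.lookup links (∈-lookup i))))
        ; separated = λ {i} {j} i≢j → λ where
            0F 0F → proj₁ (sep i≢j)
            0F 1F → ≁-sym (proj₂ (proj₂ (proj₂ (sep i≢j))))
            1F 0F → proj₁ (proj₂ (proj₂ (sep i≢j)))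
            1F 1F → proj₁ (proj₂ (sep i≢j))
        }
        where
        sep : ∀ {i j} → i ≢ j → Separate (lookup ys i) (lookup ys j)
        sep = AllPairs-lookup Separate-sym separate-ys

  -- From colour classes to a bound on the order.

  order-bounded : n ≤ k * independenceBound k c (suc k)
  order-bounded = ℕ.≮⇒≥ λ large →
    let p , I-large = popular-value colour _ (allFin n) (subst (_ <_) (≡-sym (length-tabulate id)) large)
        apart = AllPairs.zipWith (λ ((x-p , y-p) , x≢y) → monochromatic⇒≁ (trans x-p (≡-sym y-p)) , x≢y)
          (All⇒AllPairs (All.all-filter (λ x → colour x ≟ p) (allFin n)) , AllPairs.filter⁺ _ (allFin⁺ n))
    in independent-bounded (suc k) [] _ [] refl apart [] I-large

theorem3p1 : (k c : ℕ) → k ≥ 1 →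
    FinitelyManyUpToIso (λ G →
    VertexCritical k G ×
    Free ((_ , coGem) ∷ (_ , path 5) ∷ (_ , path 3 ⊕ c · path 2) ∷ []) G)
theorem3p1 k c _ = finitelyMany (k * independenceBound k c (suc k))
  λ G (critical , free) → Critical.order-bounded critical free
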